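{- For every integer $k\ge3$, there are infinitely many pairwise non-isomorphic connected $k$-regular highly-regular graphs which are not distance-regular.
   Context: A graph $\Gamma$ of order $n$ is highly-regular with collapsed adjacency matrix $C=[c_{i,j}]_{1\le i,j\le m}$, where $2\le m<n$ (the value $m=n$ allowed only when $n=2$), if for every vertex $u$ there is a partition of $V(\Gamma)$ into nonempty sets $V_1(u)=\{u\},\dots,V_m(u)$ such that every $y\in V_j(u)$ is adjacent to exactly $c_{i,j}$ vertices of $V_i(u)$. A connected graph is distance-regular if for all $u,v$ the numbers $|D_1(v)\cap D_{i-1}(u)|$, $|D_1(v)\cap D_i(u)|$, $|D_1(v)\cap D_{i+1}(u)|$ depend only on $i=d(u,v)$, where $D_i(u)=\{v:d(u,v)=i\}$. -}

module Defs where

open import Data.Fin.Base using (Fin; toℕ)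
open import Data.Fin.Properties using (any?; _≟_)
open import Data.Fin.Subset using (Subset; _∈_; _∩_; ∣_∣; ⁅_⁆; ⊥; Nonempty)
open import Data.Nat.Base using (ℕ; zero; suc; _≤_; _<_)
open import Data.Nat.Properties using (allUpTo?)
open import Data.Product.Base using (Σ-syntax; ∃-syntax; _×_; _,_)
open import Data.Sum.Base using (_⊎_)
open import Data.Vec.Base using (tabulate)
open import Function.Bundles using (_↔_; _⇔_; Inverse)
open import Level using (0ℓ)
open import Relation.Binary.Core using (Rel)
open import Relation.Binary.Definitions using (Decidable; Symmetric)
open import Relation.Binary.PropositionalEquality using (_≡_; refl)
open import Relation.Nullary.Decidable using (Dec; does; map′; ¬?; _×-dec_)
open import Relation.Nullary.Negation using (¬_)
import Relation.Unary as Unary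

-- Finite simple graphs; the vertex set of a graph of order n is Fin n.
record Graph : Set₁ where
  field
    order  : ℕ
    Adj    : Rel (Fin order) 0ℓ
    adj?   : Decidable Adj
    sym    : Symmetric Adj
    irrefl : ∀ v → ¬ Adj v v

  Vertex : Set
  Vertex = Fin order

open Graph using (order; Vertex)

_≅_ : Graph → Graph → Set
Γ ≅ Δ = Σ[ f ∈ Vertex Γ ↔ Vertex Δ ]
  (∀ u v → Graph.Adj Γ u v ⇔ Graph.Adj Δ (Inverse.to f u) (Inverse.to f v))

subset : ∀ {n} {P : Unary.Pred (Fin n) 0ℓ} → Unary.Decidable P → Subset n
subset P? = tabulate (λ v → does (P? v))

record IsPartition {n m : ℕ} (V : Fin m → Subset n) : Set where
  field
    nonempty : ∀ i → Nonempty (V i)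
    cover    : ∀ v → ∃[ i ] v ∈ V i
    disjoint : ∀ {i j v} → v ∈ V i → v ∈ V j → i ≡ j

module _ (Γ : Graph) where
  open Graph Γ using (Adj; adj?)

  neighbours : Vertex Γ → Subset (order Γ)
  neighbours v = subset (adj? v)

  Regular : ℕ → Set
  Regular k = ∀ v → ∣ neighbours v ∣ ≡ k

  data Walk : Vertex Γ → Vertex Γ → ℕ → Set where
    []  : ∀ {u} → Walk u u 0
    _∷_ : ∀ {u v w ℓ} → Adj u v → Walk v w ℓ → Walk u w (suc ℓ)

  Connected : Set
  Connected = 0 < order Γ × (∀ u v → ∃[ ℓ ] Walk u v ℓ)

  walk? : ∀ u v ℓ → Dec (Walk u v ℓ)
  walk? u v zero    = map′ (λ { refl → [] }) (λ { [] → refl }) (u ≟ v)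
  walk? u v (suc ℓ) =
    map′ (λ { (_ , a , p) → a ∷ p }) (λ { (a ∷ p) → _ , a , p })
         (any? (λ w → adj? u w ×-dec walk? w v ℓ))

  -- d(u,v) = i, where d is the length of a shortest walk.
  Distance : Vertex Γ → Vertex Γ → ℕ → Set
  Distance u v i = Walk u v i × (∀ {ℓ} → ℓ < i → ¬ Walk u v ℓ)

  distance? : ∀ u v i → Dec (Distance u v i)
  distance? u v i = walk? u v i ×-dec allUpTo? (λ ℓ → ¬? (walk? u v ℓ)) i

  D : ℕ → Vertex Γ → Subset (order Γ)
  D i u = subset (λ v → distance? u v i)

  -- D⁻ i u is D_{i-1}(u), with D_{-1}(u) empty.
  D⁻ : ℕ → Vertex Γ → Subset (order Γ)
  D⁻ zero    u = ⊥
  D⁻ (suc i) u = D i u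

  DistanceRegular : Set
  DistanceRegular = Connected ×
    (∀ i u v u′ v′ → Distance u v i → Distance u′ v′ i →
      ∣ D 1 v ∩ D⁻ i u ∣      ≡ ∣ D 1 v′ ∩ D⁻ i u′ ∣ ×
      ∣ D 1 v ∩ D i u ∣       ≡ ∣ D 1 v′ ∩ D i u′ ∣ ×
      ∣ D 1 v ∩ D (suc i) u ∣ ≡ ∣ D 1 v′ ∩ D (suc i) u′ ∣)

  -- The part V₁(u) and the first row and column of C have index 0 in Fin m.
  record HighlyRegularWith (m : ℕ) (C : Fin m → Fin m → ℕ) : Set where
    field
      2≤m       : 2 ≤ m
      m-bound   : m < order Γ ⊎ (m ≡ order Γ × order Γ ≡ 2)
      V         : Vertex Γ → Fin m → Subset (order Γ)
      partition : ∀ u → IsPartition (V u)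
      first     : ∀ u i → toℕ i ≡ 0 → V u i ≡ ⁅ u ⁆
      collapsed : ∀ u i j y → y ∈ V u j → ∣ neighbours y ∩ V u i ∣ ≡ C i j

  HighlyRegular : Set
  HighlyRegular = ∃[ m ] Σ[ C ∈ (Fin m → Fin m → ℕ) ] HighlyRegularWith m C

{-# OPTIONS --safe #-}

-- The graphs are the Cartesian products C_n □ K_{k-1} with n ≥ 5.  Cycles and complete graphs are
-- highly-regular: around u take the cells {u + i , u - i}, respectively {u} and its complement.
-- Products of cells are cells of the Cartesian product, with collapsed adjacency matrix
-- C₁ ⊗ I + I ⊗ C₂.  The vertices (2,0) and (1,1) both lie at distance 2 from (0,0), but they have
-- one, respectively two, neighbours in common with it.
module Submission where

open import Defs
open import Data.Bool.Base using (Bool; true; false; _∧_; _∨_; not)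
open import Data.Bool.Properties using (∧-zeroʳ)
open import Data.Fin.Base using (Fin; zero; suc; toℕ; fromℕ<; combine; remQuot; _↑ˡ_; _↑ʳ_)
open import Data.Fin.Patterns using (0F; 1F)
open import Data.Fin.Permutation using (↔⇒≡)
open import Data.Fin.Properties using (_≟_; toℕ-injective; toℕ-fromℕ<; toℕ<n; toℕ≤pred[n]; remQuot-combine; combine-remQuot; combine-injective)
open import Data.Fin.Subset using (Subset; inside; outside; _∈_; _∩_; ∣_∣; ⁅_⁆)
open import Data.Fin.Subset.Properties using (∣⁅x⁆∣≡1; x∈⁅x⁆; x∈⁅y⁆⇒x≡y; x∈p∩q⁺; x∈p∩q⁻; p⊂q⇒∣p∣<∣q∣; ⊆-antisym)
open import Data.Nat.Base using (ℕ; zero; suc; _+_; _*_; _∸_; _⊓_; _≤_; _<_; z≤n; s≤s; ⌊_/2⌋)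
open import Data.Nat.DivMod using (_%_; _mod_; m%n<n; m%n≤m; m%n%n≡m%n; [m+n]%n≡m%n; %-distribˡ-+; m<n⇒m%n≡m)
open import Data.Nat.Properties hiding (_≟_)
open import Data.Nat.Tactic.RingSolver using (solve-∀)
open import Data.Product.Base using (Σ-syntax; ∃-syntax; _×_; _,_; proj₁; proj₂)
open import Data.Sum.Base using (_⊎_; inj₁; inj₂)
open import Data.Vec.Base using ([]; _∷_; lookup)
open import Data.Vec.Properties using (lookup∘tabulate; lookup-zipWith; lookup⇒[]=; []=⇒lookup)
open import Function.Base using (_∘_)
open import Level using (0ℓ)
open import Relation.Binary.PropositionalEquality using (_≡_; _≢_; refl; sym; trans; cong; cong₂; subst; subst₂; module ≡-Reasoning)
open import Relation.Nullary.Decidable using (Dec; yes; no; does; ¬?; _×-dec_; _⊎-dec_; dec-true; dec-false)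
open import Relation.Nullary.Negation using (¬_; contradiction)
import Relation.Unary as Unary

open Graph using (order; Vertex)
open import Algebra.Properties.Semiring.Sum +-*-semiring using (sum; sum-cong-≗; sum-replicate-zero; ∑-distrib-+; *-distribˡ-sum; *-distribʳ-sum)

-- Counting

𝟙 : Bool → ℕ
𝟙 true  = 1
𝟙 false = 0

𝟙-∧ : ∀ b c → 𝟙 (b ∧ c) ≡ 𝟙 b * 𝟙 c
𝟙-∧ true  c = sym (+-identityʳ (𝟙 c))
𝟙-∧ false c = refl

𝟙-∨ : ∀ b c → b ∧ c ≡ false → 𝟙 (b ∨ c) ≡ 𝟙 b + 𝟙 c
𝟙-∨ true  false _ = refl
𝟙-∨ false c     _ = refl

𝟙-not : ∀ b → 𝟙 b + 𝟙 (not b) ≡ 1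
𝟙-not true  = refl
𝟙-not false = refl

∣_∣-sum : ∀ {n} (p : Subset n) → ∣ p ∣ ≡ sum (λ v → 𝟙 (lookup p v))
∣ [] ∣-sum          = refl
∣ inside ∷ p ∣-sum  = cong suc ∣ p ∣-sum
∣ outside ∷ p ∣-sum = ∣ p ∣-sum

sum-const-1 : ∀ n → sum {n} (λ _ → 1) ≡ n
sum-const-1 zero    = refl
sum-const-1 (suc n) = cong suc (sum-const-1 n)

sum-≟ : ∀ {n} (a : Fin n) (f : Fin n → ℕ) → sum (λ w → 𝟙 (does (a ≟ w)) * f w) ≡ f a
sum-≟ {suc n} zero    f = trans (cong₂ _+_ (+-identityʳ (f zero)) (sum-replicate-zero n)) (+-identityʳ (f zero))
sum-≟ {suc n} (suc a) f = sum-≟ a (f ∘ suc)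

-- The indicators of `a ≟ w` and of its negation add up to 1 and the first picks out `f a`. Hence
-- `f a + S` is `sum f`, and the truncated subtraction is exact.
sum-≢ : ∀ {n} (a : Fin n) (f : Fin n → ℕ) → sum (λ w → 𝟙 (not (does (a ≟ w))) * f w) ≡ sum f ∸ f a
sum-≢ a f = begin
  S                                              ≡⟨ m+n∸m≡n (f a) S ⟨
  f a + S ∸ f a                                  ≡⟨ cong (λ s → s + S ∸ f a) (sum-≟ a f) ⟨
  sum (λ w → 𝟙 (does (a ≟ w)) * f w) + S ∸ f a   ≡⟨ cong (_∸ f a) (∑-distrib-+ (λ w → 𝟙 (does (a ≟ w)) * f w) (λ w → 𝟙 (not (does (a ≟ w))) * f w)) ⟨
  sum (λ w → 𝟙 (does (a ≟ w)) * f w + 𝟙 (not (does (a ≟ w))) * f w) ∸ f a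
                                                 ≡⟨ cong (_∸ f a) (sum-cong-≗ collect) ⟩
  sum f ∸ f a                                    ∎
  where
  open ≡-Reasoning
  S = sum (λ w → 𝟙 (not (does (a ≟ w))) * f w)
  collect : ∀ w → 𝟙 (does (a ≟ w)) * f w + 𝟙 (not (does (a ≟ w))) * f w ≡ f w
  collect w = begin
    𝟙 b * f w + 𝟙 (not b) * f w ≡⟨ *-distribʳ-+ (f w) (𝟙 b) (𝟙 (not b)) ⟨
    (𝟙 b + 𝟙 (not b)) * f w     ≡⟨ cong (_* f w) (𝟙-not b) ⟩
    1 * f w                     ≡⟨ *-identityˡ (f w) ⟩
    f w                         ∎
    where b = does (a ≟ w)

sum-↑ : ∀ m {n} (f : Fin (m + n) → ℕ) → sum f ≡ sum (λ i → f (i ↑ˡ n)) + sum (λ j → f (m ↑ʳ j))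
sum-↑ zero    f = refl
sum-↑ (suc m) f = trans (cong (f zero +_) (sum-↑ m (f ∘ suc))) (sym (+-assoc (f zero) _ _))

-- `combine` numbers the pairs row by row, so the first `n` indices form the row of `zero` and
-- induction on `m` handles the other rows.
sum-combine : ∀ m {n} (f : Fin (m * n) → ℕ) → sum f ≡ sum {m} (λ i → sum {n} (λ j → f (combine i j)))
sum-combine zero        f = refl
sum-combine (suc m) {n} f = trans (sum-↑ n f) (cong (sum (λ j → f (j ↑ˡ (m * n))) +_) (sum-combine m (λ j → f (n ↑ʳ j))))

sum-*-sum : ∀ {m n} (f : Fin m → ℕ) (g : Fin n → ℕ) → sum (λ i → sum (λ j → f i * g j)) ≡ sum f * sum g
sum-*-sum f g = begin
  sum (λ i → sum (λ j → f i * g j)) ≡⟨ sum-cong-≗ (λ i → *-distribˡ-sum (f i) g) ⟨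
  sum (λ i → f i * sum g)           ≡⟨ *-distribʳ-sum (sum g) f ⟨
  sum f * sum g                     ∎
  where open ≡-Reasoning

module _ {n : ℕ} {P : Unary.Pred (Fin n) 0ℓ} (P? : Unary.Decidable P) where

  lookup-subset : ∀ v → lookup (subset P?) v ≡ does (P? v)
  lookup-subset = lookup∘tabulate (λ v → does (P? v))

  ∈-subset⁺ : ∀ {v} → P v → v ∈ subset P?
  ∈-subset⁺ {v} p = lookup⇒[]= v (subset P?) (trans (lookup-subset v) (dec-true (P? v) p))

  ∈-subset⁻ : ∀ {v} → v ∈ subset P? → P v
  ∈-subset⁻ {v} v∈ with P? v | trans (sym (lookup-subset v)) ([]=⇒lookup v∈)
  ... | yes p | _  = p
  ... | no _  | ()

-- Sums over neighbourhoods, and a local obstruction to distance-regularity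

module _ (Γ : Graph) where
  open Graph Γ using (Adj; adj?)

  -- The adjacency matrix applied to the vector `f`. Degrees (`f` constantly 1) and collapsed matrix
  -- entries (`f` the indicator of a part) are both of this form, so a single computation for
  -- products covers both.
  sumOverNeighbours : Vertex Γ → (Vertex Γ → ℕ) → ℕ
  sumOverNeighbours v f = sum (λ w → 𝟙 (does (adj? v w)) * f w)

  degree : ∀ v → ∣ neighbours Γ v ∣ ≡ sumOverNeighbours v (λ _ → 1)
  degree v = trans ∣ neighbours Γ v ∣-sum (sum-cong-≗ λ w →
    trans (cong 𝟙 (lookup-subset (adj? v) w)) (sym (*-identityʳ _)))

  ∣neighbours∩_∣ : ∀ {P : Unary.Pred (Vertex Γ) 0ℓ} (P? : Unary.Decidable P) v →
    ∣ neighbours Γ v ∩ subset P? ∣ ≡ sumOverNeighbours v (λ w → 𝟙 (does (P? w)))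
  ∣neighbours∩_∣ P? v = trans ∣ neighbours Γ v ∩ subset P? ∣-sum (sum-cong-≗ λ w → begin
    𝟙 (lookup (neighbours Γ v ∩ subset P?) w)
      ≡⟨ cong 𝟙 (lookup-zipWith _∧_ w (neighbours Γ v) (subset P?)) ⟩
    𝟙 (lookup (neighbours Γ v) w ∧ lookup (subset P?) w)
      ≡⟨ cong₂ (λ b c → 𝟙 (b ∧ c)) (lookup-subset (adj? v) w) (lookup-subset P? w) ⟩
    𝟙 (does (adj? v w) ∧ does (P? w))
      ≡⟨ 𝟙-∧ (does (adj? v w)) (does (P? w)) ⟩
    𝟙 (does (adj? v w)) * 𝟙 (does (P? w)) ∎)
    where open ≡-Reasoning

  _++ʷ_ : ∀ {u v w k l} → Walk Γ u v k → Walk Γ v w l → Walk Γ u w (k + l)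
  []      ++ʷ q = q
  (a ∷ p) ++ʷ q = a ∷ (p ++ʷ q)

  adj⇒distance-1 : ∀ {u v} → Adj u v → Distance Γ u v 1
  adj⇒distance-1 a = a ∷ [] , λ { (s≤s z≤n) [] → Graph.irrefl Γ _ a }

  distance-1⇒adj : ∀ {u v} → Distance Γ u v 1 → Adj u v
  distance-1⇒adj (a ∷ [] , _) = a

  distance-2 : ∀ {u v w} → Adj u w → Adj w v → u ≢ v → ¬ Adj u v → Distance Γ u v 2
  distance-2 a b u≢v ¬uv = a ∷ (b ∷ []) , λ where
    (s≤s z≤n)       []       → u≢v refl
    (s≤s (s≤s z≤n)) (c ∷ []) → ¬uv c

  -- At distance 2 the first set in `DistanceRegular` is `D Γ 1 v ∩ D⁻ Γ 2 u`, which unfolds to the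
  -- intersection used here: the set of common neighbours.
  ∈-common⁺ : ∀ {u v w} → Adj u w → Adj v w → w ∈ D Γ 1 v ∩ D Γ 1 u
  ∈-common⁺ {u} {v} a b = x∈p∩q⁺ ( ∈-subset⁺ (λ z → distance? Γ v z 1) (adj⇒distance-1 b)
                               , ∈-subset⁺ (λ z → distance? Γ u z 1) (adj⇒distance-1 a))

  ∈-common⁻ : ∀ {u v w} → w ∈ D Γ 1 v ∩ D Γ 1 u → Adj u w × Adj v w
  ∈-common⁻ {u} {v} w∈ with x∈p∩q⁻ (D Γ 1 v) (D Γ 1 u) w∈
  ... | w∈v , w∈u = distance-1⇒adj (∈-subset⁻ (λ z → distance? Γ u z 1) w∈u)
                  , distance-1⇒adj (∈-subset⁻ (λ z → distance? Γ v z 1) w∈v)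

  -- The intersection number c₂ would have to be 1 because of the pair `u`, `v` and at least 2
  -- because of the pair `u`, `v′`.
  ¬distanceRegular : ∀ {u v v′ w w₁ w₂} → Distance Γ u v 2 → Distance Γ u v′ 2 →
    Adj u w → Adj v w → (∀ {z} → Adj u z → Adj v z → z ≡ w) →
    Adj u w₁ → Adj v′ w₁ → Adj u w₂ → Adj v′ w₂ → w₁ ≢ w₂ → ¬ DistanceRegular Γ
  ¬distanceRegular {u} {v} {v′} {w} {w₁} {w₂} d d′ uw vw unique uw₁ v′w₁ uw₂ v′w₂ w₁≢w₂ (_ , dr) =
    contradiction 1<1 (<-irrefl refl)
    where
    common≡⁅w⁆ : D Γ 1 v ∩ D Γ 1 u ≡ ⁅ w ⁆
    common≡⁅w⁆ = ⊆-antisym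
      (λ {z} z∈ → let uz , vz = ∈-common⁻ z∈ in subst (_∈ ⁅ w ⁆) (sym (unique uz vz)) (x∈⁅x⁆ w))
      (λ {z} z∈ → subst (_∈ D Γ 1 v ∩ D Γ 1 u) (sym (x∈⁅y⁆⇒x≡y w z∈)) (∈-common⁺ uw vw))
    -- Two common neighbours are counted through a strict inclusion: the singleton of `w₁` misses
    -- `w₂`.
    ⁅w₁⁆<common : ∣ ⁅ w₁ ⁆ ∣ < ∣ D Γ 1 v′ ∩ D Γ 1 u ∣
    ⁅w₁⁆<common = p⊂q⇒∣p∣<∣q∣
      ( (λ {z} z∈ → subst (_∈ D Γ 1 v′ ∩ D Γ 1 u) (sym (x∈⁅y⁆⇒x≡y w₁ z∈)) (∈-common⁺ uw₁ v′w₁))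
      , w₂ , ∈-common⁺ uw₂ v′w₂ , λ w₂∈ → w₁≢w₂ (sym (x∈⁅y⁆⇒x≡y w₁ w₂∈)))
    1<1 : 1 < 1
    1<1 = subst₂ _<_ (∣⁅x⁆∣≡1 w₁)
      (trans (sym (proj₁ (dr 2 u v u v′ d d′))) (trans (cong ∣_∣ common≡⁅w⁆) (∣⁅x⁆∣≡1 w)))
      ⁅w₁⁆<common

-- Partitions given by a colouring

-- cell u v is the index of the part of the partition around u that contains v; there are suc m parts.
record Collapse (Γ : Graph) (m : ℕ) : Set where
  field
    cell        : Vertex Γ → Vertex Γ → Fin (suc m)
    cell-refl   : ∀ u → cell u u ≡ zero
    cell-zero   : ∀ {u v} → cell u v ≡ zero → v ≡ u
    cell-onto   : ∀ u i → ∃[ v ] cell u v ≡ i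
    C           : Fin (suc m) → Fin (suc m) → ℕ
    C-collapses : ∀ u i y → sumOverNeighbours Γ y (λ w → 𝟙 (does (cell u w ≟ i))) ≡ C i (cell u y)

-- The parts around `u` are the fibres of `cell u`; being fibres, they are disjoint and cover. The
-- index `suc m` guarantees at least two of them.
collapse⇒highlyRegular : ∀ {Γ m} → Collapse Γ (suc m) → suc (suc m) < order Γ → HighlyRegular Γ
collapse⇒highlyRegular {Γ} {m} 𝒞 m<n = suc (suc m) , C , record
  { 2≤m       = s≤s (s≤s z≤n)
  ; m-bound   = inj₁ m<n
  ; V         = V
  ; partition = λ u → record
    { nonempty = λ i → let v , eq = cell-onto u i in v , ∈-subset⁺ (λ v → cell u v ≟ i) eq
    ; cover    = λ v → cell u v , ∈-subset⁺ (λ w → cell u w ≟ cell u v) refl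
    ; disjoint = λ {i} {j} v∈i v∈j → trans (sym (V⁻ v∈i)) (V⁻ v∈j)
    }
  ; first     = λ { u zero _ → ⊆-antisym
      (λ v∈ → subst (_∈ ⁅ u ⁆) (sym (cell-zero (V⁻ v∈))) (x∈⁅x⁆ u))
      (λ v∈ → ∈-subset⁺ (λ v → cell u v ≟ zero) (subst (λ v → cell u v ≡ zero) (sym (x∈⁅y⁆⇒x≡y u v∈)) (cell-refl u))) }
  ; collapsed = λ u i j y y∈ → trans (∣neighbours∩_∣ Γ (λ v → cell u v ≟ i) y)
      (trans (C-collapses u i y) (cong (C i) (V⁻ y∈)))
  }
  where
  open Collapse 𝒞
  V : Vertex Γ → Fin (suc (suc m)) → Subset (order Γ)
  V u i = subset (λ v → cell u v ≟ i)
  V⁻ : ∀ {u i v} → v ∈ V u i → cell u v ≡ i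
  V⁻ {u} {i} = ∈-subset⁻ (λ v → cell u v ≟ i)

-- Cartesian products

module Cartesian (Γ Δ : Graph) where
  private
    module Γ = Graph Γ
    module Δ = Graph Δ

  -- Adjacency is stated on pairs, where its cases can be matched directly; `split` transports it to
  -- the numbered vertices.
  PairAdj : Vertex Γ × Vertex Δ → Vertex Γ × Vertex Δ → Set
  PairAdj (x , a) (z , c) = (x ≡ z × Δ.Adj a c) ⊎ (Γ.Adj x z × a ≡ c)

  pairAdj? : ∀ p q → Dec (PairAdj p q)
  pairAdj? (x , a) (z , c) = ((x ≟ z) ×-dec Δ.adj? a c) ⊎-dec (Γ.adj? x z ×-dec (a ≟ c))

  pairAdj-sym : ∀ {p q} → PairAdj p q → PairAdj q p
  pairAdj-sym (inj₁ (eq , a)) = inj₁ (sym eq , Δ.sym a)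
  pairAdj-sym (inj₂ (a , eq)) = inj₂ (Γ.sym a , sym eq)

  pairAdj-irrefl : ∀ p → ¬ PairAdj p p
  pairAdj-irrefl (x , a) (inj₁ (_ , aa)) = Δ.irrefl a aa
  pairAdj-irrefl (x , a) (inj₂ (xx , _)) = Γ.irrefl x xx

  split : Fin (order Γ * order Δ) → Vertex Γ × Vertex Δ
  split = remQuot (order Δ)

  product : Graph
  product = record
    { order  = order Γ * order Δ
    ; Adj    = λ p q → PairAdj (split p) (split q)
    ; adj?   = λ p q → pairAdj? (split p) (split q)
    ; sym    = pairAdj-sym
    ; irrefl = λ p → pairAdj-irrefl (split p)
    }

  open Graph product using (Adj; adj?)

  split-combine : ∀ x a → split (combine x a) ≡ (x , a)
  split-combine = remQuot-combine

  adj-combine : ∀ {x a z c} → PairAdj (x , a) (z , c) → Adj (combine x a) (combine z c)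
  adj-combine {x} {a} {z} {c} = subst₂ PairAdj (sym (split-combine x a)) (sym (split-combine z c))

  -- The adjacency matrix of the product is I ⊗ A(Δ) + A(Γ) ⊗ I; here it is applied to a vector `h`
  -- that is the pure tensor of `f` and `g`.
  sumOverNeighbours-product : ∀ x a (f : Vertex Γ → ℕ) (g : Vertex Δ → ℕ) (h : Vertex product → ℕ) →
    (∀ z c → h (combine z c) ≡ f z * g c) →
    sumOverNeighbours product (combine x a) h ≡
    f x * sumOverNeighbours Δ a g + sumOverNeighbours Γ x f * g a
  sumOverNeighbours-product x a f g h h≡ = begin
    sumOverNeighbours product (combine x a) h
      ≡⟨ sum-combine (order Γ) {order Δ} (λ w → 𝟙 (does (adj? (combine x a) w)) * h w) ⟩
    sum {order Γ} (λ z → sum {order Δ} (λ c → 𝟙 (does (adj? (combine x a) (combine z c))) * h (combine z c)))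
      ≡⟨ sum-cong-≗ (λ z → trans (sum-cong-≗ (expand z)) (∑-distrib-+ (λ c → f₁ z * g₁ c) (λ c → f₂ z * g₂ c))) ⟩
    sum (λ z → sum (λ c → f₁ z * g₁ c) + sum (λ c → f₂ z * g₂ c))
      ≡⟨ ∑-distrib-+ (λ z → sum (λ c → f₁ z * g₁ c)) (λ z → sum (λ c → f₂ z * g₂ c)) ⟩
    sum (λ z → sum (λ c → f₁ z * g₁ c)) + sum (λ z → sum (λ c → f₂ z * g₂ c))
      ≡⟨ cong₂ _+_ (sum-*-sum f₁ g₁) (sum-*-sum f₂ g₂) ⟩
    sum f₁ * sum g₁ + sum f₂ * sum g₂
      ≡⟨ cong₂ (λ s t → s * sum g₁ + sum f₂ * t) (sum-≟ x f) (sum-≟ a g) ⟩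
    f x * sumOverNeighbours Δ a g + sumOverNeighbours Γ x f * g a ∎
    where
    open ≡-Reasoning
    f₁ f₂ : Vertex Γ → ℕ
    f₁ z = 𝟙 (does (x ≟ z)) * f z
    f₂ z = 𝟙 (does (Γ.adj? x z)) * f z
    g₁ g₂ : Vertex Δ → ℕ
    g₁ c = 𝟙 (does (Δ.adj? a c)) * g c
    g₂ c = 𝟙 (does (a ≟ c)) * g c
    -- `x ≡ z` and `Γ.Adj x z` exclude each other by irreflexivity, so the disjunction in `PairAdj`
    -- becomes a sum of indicators.
    exclusive : ∀ z b b′ → (does (x ≟ z) ∧ b) ∧ (does (Γ.adj? x z) ∧ b′) ≡ false
    exclusive z b b′ with x ≟ z
    ... | no _ = refl
    ... | yes refl rewrite dec-false (Γ.adj? x x) (Γ.irrefl x) = ∧-zeroʳ b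
    expand : ∀ z c → 𝟙 (does (adj? (combine x a) (combine z c))) * h (combine z c) ≡ f₁ z * g₁ c + f₂ z * g₂ c
    expand z c = begin
      𝟙 (does (adj? (combine x a) (combine z c))) * h (combine z c)
        ≡⟨ cong₂ _*_ (cong₂ (λ p q → 𝟙 (does (pairAdj? p q))) (split-combine x a) (split-combine z c)) (h≡ z c) ⟩
      𝟙 (b₁ ∧ b₂ ∨ b₃ ∧ b₄) * (f z * g c)
        ≡⟨ cong (_* (f z * g c)) (𝟙-∨ (b₁ ∧ b₂) (b₃ ∧ b₄) (exclusive z b₂ b₄)) ⟩
      (𝟙 (b₁ ∧ b₂) + 𝟙 (b₃ ∧ b₄)) * (f z * g c)
        ≡⟨ cong₂ (λ s t → (s + t) * (f z * g c)) (𝟙-∧ b₁ b₂) (𝟙-∧ b₃ b₄) ⟩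
      (𝟙 b₁ * 𝟙 b₂ + 𝟙 b₃ * 𝟙 b₄) * (f z * g c)
        ≡⟨ regroup (𝟙 b₁) (𝟙 b₂) (𝟙 b₃) (𝟙 b₄) (f z) (g c) ⟩
      f₁ z * g₁ c + f₂ z * g₂ c ∎
      where
      b₁ = does (x ≟ z)
      b₂ = does (Δ.adj? a c)
      b₃ = does (Γ.adj? x z)
      b₄ = does (a ≟ c)
      regroup : ∀ p q r s t u → (p * q + r * s) * (t * u) ≡ (p * t) * (q * u) + (r * t) * (s * u)
      regroup = solve-∀

  -- Every vertex is of the form `combine x a`. This reduces claims about the product to
  -- coordinates, where `split-combine` applies.
  via-combine : ∀ (P : Vertex product → Set) → (∀ (x : Vertex Γ) (a : Vertex Δ) → P (combine x a)) → ∀ p → P p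
  via-combine P P-combine p = subst P (combine-remQuot {order Γ} (order Δ) p) (P-combine _ _)

  regular : ∀ {k l} → Regular Γ k → Regular Δ l → Regular product (k + l)
  regular {k} {l} Γ-regular Δ-regular = via-combine (λ p → ∣ neighbours product p ∣ ≡ k + l) λ x a → begin
    ∣ neighbours product (combine x a) ∣
      ≡⟨ degree product (combine x a) ⟩
    sumOverNeighbours product (combine x a) (λ _ → 1)
      ≡⟨ sumOverNeighbours-product x a (λ _ → 1) (λ _ → 1) (λ _ → 1) (λ _ _ → refl) ⟩
    1 * sumOverNeighbours Δ a (λ _ → 1) + sumOverNeighbours Γ x (λ _ → 1) * 1
      ≡⟨ cong₂ (λ s t → 1 * s + t * 1) (trans (sym (degree Δ a)) (Δ-regular a)) (trans (sym (degree Γ x)) (Γ-regular x)) ⟩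
    1 * l + k * 1
      ≡⟨ cong₂ _+_ (*-identityˡ l) (*-identityʳ k) ⟩
    l + k
      ≡⟨ +-comm l k ⟩
    k + l ∎
    where open ≡-Reasoning

  walkˡ : ∀ {x z ℓ} (a : Vertex Δ) → Walk Γ x z ℓ → Walk product (combine x a) (combine z a) ℓ
  walkˡ a []      = []
  walkˡ a (e ∷ p) = adj-combine (inj₂ (e , refl)) ∷ walkˡ a p

  walkʳ : ∀ {a c ℓ} (x : Vertex Γ) → Walk Δ a c ℓ → Walk product (combine x a) (combine x c) ℓ
  walkʳ x []      = []
  walkʳ x (e ∷ p) = adj-combine (inj₁ (refl , e)) ∷ walkʳ x p

  connected : Connected Γ → Connected Δ → Connected product
  connected (0<m , Γ-walk) (0<n , Δ-walk) = *-mono-< 0<m 0<n ,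
    via-combine (λ p → ∀ q → ∃[ ℓ ] Walk product p q ℓ) λ x a →
    via-combine (λ q → ∃[ ℓ ] Walk product (combine x a) q ℓ) λ z c →
      -- Walk in `Γ` with `a` fixed, then in `Δ` with `z` fixed.
      _ , _++ʷ_ product (walkˡ a (proj₂ (Γ-walk x z))) (walkʳ z (proj₂ (Δ-walk a c)))

  module _ {m n : ℕ} (𝒞 : Collapse Γ m) (𝒟 : Collapse Δ n) where
    private
      module 𝒞 = Collapse 𝒞
      module 𝒟 = Collapse 𝒟

      pairCell : Vertex Γ × Vertex Δ → Vertex Γ × Vertex Δ → Fin (suc m * suc n)
      pairCell (x , a) (z , c) = combine (𝒞.cell x z) (𝒟.cell a c)

      cell′ : Vertex product → Vertex product → Fin (suc m * suc n)
      cell′ p q = pairCell (split p) (split q)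

      cell′-combine : ∀ x a z c → cell′ (combine x a) (combine z c) ≡ combine (𝒞.cell x z) (𝒟.cell a c)
      cell′-combine x a z c = cong₂ pairCell (split-combine x a) (split-combine z c)

      pairC : Fin (suc m) × Fin (suc n) → Fin (suc m) × Fin (suc n) → ℕ
      pairC (i , j) (i′ , j′) = 𝟙 (does (i′ ≟ i)) * 𝒟.C j j′ + 𝒞.C i i′ * 𝟙 (does (j′ ≟ j))

      C′ : Fin (suc m * suc n) → Fin (suc m * suc n) → ℕ
      C′ i j = pairC (remQuot (suc n) i) (remQuot (suc n) j)

      combine-≟ : ∀ (i i′ : Fin (suc m)) (j j′ : Fin (suc n)) →
        does (combine i j ≟ combine i′ j′) ≡ does (i ≟ i′) ∧ does (j ≟ j′)
      combine-≟ i i′ j j′ with i ≟ i′ | j ≟ j′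
      ... | yes refl | yes refl = dec-true (combine i j ≟ combine i j) refl
      ... | yes _    | no j≢j′  = dec-false (combine i j ≟ combine i′ j′) (λ eq → j≢j′ (proj₂ (combine-injective i j i′ j′ eq)))
      ... | no i≢i′  | _        = dec-false (combine i j ≟ combine i′ j′) (λ eq → i≢i′ (proj₁ (combine-injective i j i′ j′ eq)))

      Collapses : Vertex product → Fin (suc m * suc n) → Vertex product → Set
      Collapses p i q = sumOverNeighbours product q (λ w → 𝟙 (does (cell′ p w ≟ i))) ≡ C′ i (cell′ p q)

      -- The indicator of a product cell is the product of the indicators of its factors, so
      -- `sumOverNeighbours-product` applies. The undifferentiated factors `f z` and `g c` are the
      -- identity matrix entries in `pairC`.
      C′-collapses : ∀ x a i j z c → Collapses (combine x a) (combine i j) (combine z c)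
      C′-collapses x a i j z c = begin
        sumOverNeighbours product (combine z c) (λ w → 𝟙 (does (cell′ (combine x a) w ≟ combine i j)))
          ≡⟨ sumOverNeighbours-product z c f g _ factor ⟩
        f z * sumOverNeighbours Δ c g + sumOverNeighbours Γ z f * g c
          ≡⟨ cong₂ (λ s t → f z * s + t * g c) (𝒟.C-collapses a j c) (𝒞.C-collapses x i z) ⟩
        pairC (i , j) (𝒞.cell x z , 𝒟.cell a c)
          ≡⟨ cong₂ pairC (remQuot-combine i j) (remQuot-combine (𝒞.cell x z) (𝒟.cell a c)) ⟨
        C′ (combine i j) (combine (𝒞.cell x z) (𝒟.cell a c))
          ≡⟨ cong (C′ (combine i j)) (cell′-combine x a z c) ⟨
        C′ (combine i j) (cell′ (combine x a) (combine z c)) ∎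
        where
        open ≡-Reasoning
        f : Vertex Γ → ℕ
        f w = 𝟙 (does (𝒞.cell x w ≟ i))
        g : Vertex Δ → ℕ
        g w = 𝟙 (does (𝒟.cell a w ≟ j))
        factor : ∀ w v → 𝟙 (does (cell′ (combine x a) (combine w v) ≟ combine i j)) ≡ f w * g v
        factor w v = begin
          𝟙 (does (cell′ (combine x a) (combine w v) ≟ combine i j))
            ≡⟨ cong (λ e → 𝟙 (does (e ≟ combine i j))) (cell′-combine x a w v) ⟩
          𝟙 (does (combine (𝒞.cell x w) (𝒟.cell a v) ≟ combine i j))
            ≡⟨ cong 𝟙 (combine-≟ (𝒞.cell x w) i (𝒟.cell a v) j) ⟩
          𝟙 (does (𝒞.cell x w ≟ i) ∧ does (𝒟.cell a v ≟ j))
            ≡⟨ 𝟙-∧ (does (𝒞.cell x w ≟ i)) (does (𝒟.cell a v ≟ j)) ⟩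
          f w * g v ∎

      cell′-zero : ∀ x a z c → cell′ (combine x a) (combine z c) ≡ zero → combine z c ≡ combine x a
      cell′-zero x a z c eq =
        -- `combine zero zero` computes to `zero`, so the first cell of the product is the product
        -- of the first cells.
        let eq₁ , eq₂ = combine-injective (𝒞.cell x z) (𝒟.cell a c) zero zero (trans (sym (cell′-combine x a z c)) eq)
        in cong₂ combine (𝒞.cell-zero eq₁) (𝒟.cell-zero eq₂)

    -- The number of parts `suc m * suc n` computes to `suc (n + m * suc n)`, whence the index.
    collapse : Collapse product (n + m * suc n)
    collapse = record
      { cell        = cell′
      ; cell-refl   = λ p → cong₂ combine (𝒞.cell-refl (proj₁ (split p))) (𝒟.cell-refl (proj₂ (split p)))
      ; cell-zero   = λ {p} {q} → via-combine (λ p → ∀ q → cell′ p q ≡ zero → q ≡ p)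
          (λ x a → via-combine (λ q → cell′ (combine x a) q ≡ zero → q ≡ combine x a) (cell′-zero x a)) p q
      ; cell-onto   = via-combine (λ p → ∀ i → ∃[ q ] cell′ p q ≡ i) λ x a i →
          let i₁ , i₂ = remQuot {suc m} (suc n) i
              z , eq₁ = 𝒞.cell-onto x i₁
              c , eq₂ = 𝒟.cell-onto a i₂
          in combine z c , trans (cell′-combine x a z c)
               (trans (cong₂ combine eq₁ eq₂) (combine-remQuot {suc m} (suc n) i))
      ; C           = C′
      ; C-collapses = λ p i q → via-combine (λ p → ∀ q → Collapses p i q)
          (λ x a → via-combine (Collapses (combine x a) i) λ z c →
            subst (λ i → Collapses (combine x a) i (combine z c)) (combine-remQuot {suc m} (suc n) i)
              (C′-collapses x a (proj₁ (remQuot {suc m} (suc n) i)) (proj₂ (remQuot {suc m} (suc n) i)) z c))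
          p q
      }

  -- From (x,a), the vertex (z,a) is reached in two steps only through (y,a), whereas (y,b) is
  -- reached through both (y,a) and (x,b).
  ¬distanceRegular-product : ∀ {x y z a b} → Γ.Adj x y → Γ.Adj y z → x ≢ z → ¬ Γ.Adj x z →
    (∀ {w} → Γ.Adj x w → Γ.Adj z w → w ≡ y) → Δ.Adj a b → ¬ DistanceRegular product
  ¬distanceRegular-product {x} {y} {z} {a} {b} xy yz x≢z ¬xz unique ab =
    ¬distanceRegular product {combine x a} {combine z a} {combine y b} {combine y a} {combine y a} {combine x b}
      (distance-2 product xa∼ya (adj-combine (inj₂ (yz , refl)))
        (λ eq → x≢z (proj₁ (combine-injective x a z a eq)))
        (λ e → ¬adj₁ (subst₂ PairAdj (split-combine x a) (split-combine z a) e)))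
      (distance-2 product xa∼ya ya∼yb
        (λ eq → x≢y (proj₁ (combine-injective x a y b eq)))
        (λ e → ¬adj₂ (subst₂ PairAdj (split-combine x a) (split-combine y b) e)))
      xa∼ya (adj-combine (inj₂ (Γ.sym yz , refl)))
      (λ {w} → via-combine (λ w → Adj (combine x a) w → Adj (combine z a) w → w ≡ combine y a) unique′ w)
      xa∼ya (Graph.sym product {combine y a} {combine y b} ya∼yb)
      (adj-combine (inj₁ (refl , ab))) (adj-combine (inj₂ (Γ.sym xy , refl)))
      (λ eq → x≢y (sym (proj₁ (combine-injective y a x b eq))))
    where
    xa∼ya = adj-combine {x} {a} {y} {a} (inj₂ (xy , refl))
    ya∼yb = adj-combine {y} {a} {y} {b} (inj₁ (refl , ab))
    x≢y : x ≢ y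
    x≢y refl = Γ.irrefl x xy
    ¬adj₁ : ¬ PairAdj (x , a) (z , a)
    ¬adj₁ (inj₁ (x≡z , _)) = x≢z x≡z
    ¬adj₁ (inj₂ (xz , _))  = ¬xz xz
    ¬adj₂ : ¬ PairAdj (x , a) (y , b)
    ¬adj₂ (inj₁ (x≡y , _))  = x≢y x≡y
    ¬adj₂ (inj₂ (_ , refl)) = Δ.irrefl a ab
    -- Two steps in `Δ` would give `x ≡ z`, and one step in each factor would make `a` adjacent to
    -- itself; two steps in `Γ` remain.
    unique-pair : ∀ {w c} → PairAdj (x , a) (w , c) → PairAdj (z , a) (w , c) → combine w c ≡ combine y a
    unique-pair (inj₁ (refl , _))  (inj₁ (z≡x , _))  = contradiction (sym z≡x) x≢z
    unique-pair (inj₁ (refl , ac)) (inj₂ (_ , refl)) = contradiction ac (Δ.irrefl a)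
    unique-pair (inj₂ (_ , refl))  (inj₁ (_ , aa))   = contradiction aa (Δ.irrefl a)
    unique-pair (inj₂ (xw , refl)) (inj₂ (zw , _))   = cong (λ w → combine w a) (unique xw zw)
    unique′ : ∀ w c → Adj (combine x a) (combine w c) → Adj (combine z a) (combine w c) → combine w c ≡ combine y a
    unique′ w c e e′ = unique-pair
      (subst₂ PairAdj (split-combine x a) (split-combine w c) e)
      (subst₂ PairAdj (split-combine z a) (split-combine w c) e′)

-- Complete graphs

complete : ℕ → Graph
complete n = record
  { order  = n
  ; Adj    = _≢_
  ; adj?   = λ x y → ¬? (x ≟ y)
  ; sym    = λ x≢y y≡x → x≢y (sym y≡x)
  ; irrefl = λ v v≢v → v≢v refl
  }

complete-regular : ∀ q → Regular (complete (suc q)) q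
complete-regular q v = begin
  ∣ neighbours (complete (suc q)) v ∣                ≡⟨ degree (complete (suc q)) v ⟩
  sum (λ w → 𝟙 (not (does (v ≟ w))) * 1)             ≡⟨ sum-≢ v (λ _ → 1) ⟩
  sum {q} (λ _ → 1)                                  ≡⟨ sum-const-1 q ⟩
  q                                                  ∎
  where open ≡-Reasoning

complete-connected : ∀ q → Connected (complete (suc q))
complete-connected q = s≤s z≤n , walk
  where
  walk : ∀ u v → ∃[ ℓ ] Walk (complete (suc q)) u v ℓ
  walk u v with u ≟ v
  ... | yes refl = 0 , []
  ... | no u≢v   = 1 , u≢v ∷ []

-- At least two vertices are present, so that the complement of `u` is a nonempty part.
complete-collapse : ∀ q → Collapse (complete (2 + q)) 1
complete-collapse q = record
  { cell        = cell
  ; cell-refl   = λ u → cong colour (dec-true (u ≟ u) refl)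
  ; cell-zero   = cell-zero
  ; cell-onto   = λ { u 0F → u , cong colour (dec-true (u ≟ u) refl)
                    ; u 1F → let v , u≢v = other u in v , cong colour (dec-false (u ≟ v) u≢v) }
  -- A vertex is adjacent to everything in part `i` except itself, if it lies there. Both sizes are
  -- positive, so the subtraction is exact.
  ; C           = λ i j → size i ∸ 𝟙 (does (j ≟ i))
  ; C-collapses = λ u i y → trans (sum-≢ y (λ w → 𝟙 (does (cell u w ≟ i))))
                                  (cong (_∸ 𝟙 (does (cell u y ≟ i))) (cell-size u i))
  }
  where
  colour : Bool → Fin 2
  colour true  = 0F
  colour false = 1F
  cell : Fin (2 + q) → Fin (2 + q) → Fin 2
  cell u v = colour (does (u ≟ v))
  cell-zero : ∀ {u v} → cell u v ≡ zero → v ≡ u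
  cell-zero {u} {v} eq with u ≟ v
  ... | yes u≡v = sym u≡v
  cell-zero () | no _
  other : ∀ (u : Fin (2 + q)) → ∃[ v ] u ≢ v
  other zero    = 1F , λ ()
  other (suc _) = 0F , λ ()
  size : Fin 2 → ℕ
  size 0F = 1
  size 1F = suc q
  -- The factor 1 gives the summand the shape required by `sum-≟` and `sum-≢` for the constant
  -- function 1.
  colour-0F : ∀ b → 𝟙 (does (colour b ≟ 0F)) ≡ 𝟙 b * 1
  colour-0F true  = refl
  colour-0F false = refl
  colour-1F : ∀ b → 𝟙 (does (colour b ≟ 1F)) ≡ 𝟙 (not b) * 1
  colour-1F true  = refl
  colour-1F false = refl
  cell-size : ∀ u i → sum (λ w → 𝟙 (does (cell u w ≟ i))) ≡ size i
  cell-size u 0F = trans (sum-cong-≗ (λ w → colour-0F (does (u ≟ w)))) (sum-≟ u (λ _ → 1))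
  cell-size u 1F = trans (sum-cong-≗ (λ w → colour-1F (does (u ≟ w))))
    (trans (sum-≢ u (λ _ → 1)) (sum-const-1 (suc q)))

-- Cycles

module Cyclic (r : ℕ) where

  n : ℕ
  n = suc r

  infixl 6 _⊕_

  -- Translation in ℤ/n by a natural number. Translating back by `a` is translating by any `b` with
  -- `a + b ≡ n`.
  _⊕_ : Fin n → ℕ → Fin n
  x ⊕ a = (toℕ x + a) mod n

  toℕ-⊕ : ∀ x a → toℕ (x ⊕ a) ≡ (toℕ x + a) % n
  toℕ-⊕ x a = toℕ-fromℕ< (m%n<n (toℕ x + a) n)

  %-+ : ∀ a b → (a % n + b) % n ≡ (a + b) % n
  %-+ a b = begin
    (a % n + b) % n         ≡⟨ %-distribˡ-+ (a % n) b n ⟩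
    (a % n % n + b % n) % n ≡⟨ cong (λ t → (t + b % n) % n) (m%n%n≡m%n a n) ⟩
    (a % n + b % n) % n     ≡⟨ %-distribˡ-+ a b n ⟨
    (a + b) % n             ∎
    where open ≡-Reasoning

  ⊕-assoc : ∀ x a b → x ⊕ a ⊕ b ≡ x ⊕ (a + b)
  ⊕-assoc x a b = toℕ-injective (begin
    toℕ (x ⊕ a ⊕ b)               ≡⟨ toℕ-⊕ (x ⊕ a) b ⟩
    (toℕ (x ⊕ a) + b) % n         ≡⟨ cong (λ t → (t + b) % n) (toℕ-⊕ x a) ⟩
    ((toℕ x + a) % n + b) % n     ≡⟨ %-+ (toℕ x + a) b ⟩
    (toℕ x + a + b) % n           ≡⟨ cong (_% n) (+-assoc (toℕ x) a b) ⟩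
    (toℕ x + (a + b)) % n         ≡⟨ toℕ-⊕ x (a + b) ⟨
    toℕ (x ⊕ (a + b))             ∎)
    where open ≡-Reasoning

  ⊕-swap : ∀ x a b → x ⊕ a ⊕ b ≡ x ⊕ b ⊕ a
  ⊕-swap x a b = trans (⊕-assoc x a b) (trans (cong (x ⊕_) (+-comm a b)) (sym (⊕-assoc x b a)))

  ⊕-comm : ∀ x y → x ⊕ toℕ y ≡ y ⊕ toℕ x
  ⊕-comm x y = cong (_mod n) (+-comm (toℕ x) (toℕ y))

  ⊕-n : ∀ x → x ⊕ n ≡ x
  ⊕-n x = toℕ-injective (trans (toℕ-⊕ x n) (trans ([m+n]%n≡m%n (toℕ x) n) (m<n⇒m%n≡m (toℕ<n x))))

  ⊕-0 : ∀ x → x ⊕ 0 ≡ x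
  ⊕-0 x = toℕ-injective (trans (toℕ-⊕ x 0) (trans (cong (_% n) (+-identityʳ (toℕ x))) (m<n⇒m%n≡m (toℕ<n x))))

  ⊕-undo : ∀ x a b → a + b ≡ n → x ⊕ a ⊕ b ≡ x
  ⊕-undo x a b a+b≡n = trans (⊕-assoc x a b) (trans (cong (x ⊕_) a+b≡n) (⊕-n x))

  toℕ-zero⊕ : ∀ {a} → a < n → toℕ (zero ⊕ a) ≡ a
  toℕ-zero⊕ {a} a<n = trans (toℕ-⊕ zero a) (m<n⇒m%n≡m a<n)

  -- The residue v - u, with `n ∸ toℕ u` standing for -u.
  diff : Fin n → Fin n → Fin n
  diff u v = v ⊕ (n ∸ toℕ u)

  ⊕-diff : ∀ u v → u ⊕ toℕ (diff u v) ≡ v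
  ⊕-diff u v = trans (⊕-comm u (diff u v)) (⊕-undo v (n ∸ toℕ u) (toℕ u) (m∸n+n≡m (<⇒≤ (toℕ<n u))))

  diff-⊕ : ∀ u v a → diff u (v ⊕ a) ≡ diff u v ⊕ a
  diff-⊕ u v a = ⊕-swap v a (n ∸ toℕ u)

  diff-unique : ∀ u v d → u ⊕ toℕ d ≡ v → d ≡ diff u v
  diff-unique u v d refl = begin
    d                             ≡⟨ ⊕-undo d (toℕ u) (n ∸ toℕ u) (m+[n∸m]≡n (<⇒≤ (toℕ<n u))) ⟨
    d ⊕ toℕ u ⊕ (n ∸ toℕ u)       ≡⟨ cong (_⊕ (n ∸ toℕ u)) (⊕-comm d u) ⟩
    u ⊕ toℕ d ⊕ (n ∸ toℕ u)       ∎
    where open ≡-Reasoning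

  diff-self : ∀ u → diff u u ≡ zero
  diff-self u = sym (diff-unique u u zero (⊕-0 u))

  diff-zero : ∀ {u v} → diff u v ≡ zero → v ≡ u
  diff-zero {u} {v} eq = trans (sym (⊕-diff u v)) (trans (cong (λ d → u ⊕ toℕ d) eq) (⊕-0 u))

  diff-self-⊕ : ∀ u a → diff u (u ⊕ a) ≡ zero ⊕ a
  diff-self-⊕ u a = trans (diff-⊕ u u a) (cong (_⊕ a) (diff-self u))

  -- Subtracting `x` moves the base point to `zero`, where `toℕ` reads off a shift below `n`.
  ⊕-injective : ∀ x {a b} → a < n → b < n → x ⊕ a ≡ x ⊕ b → a ≡ b
  ⊕-injective x {a} {b} a<n b<n eq = begin
    a              ≡⟨ toℕ-zero⊕ a<n ⟨
    toℕ (zero ⊕ a) ≡⟨ cong toℕ (trans (sym (diff-self-⊕ x a)) (trans (cong (diff x) eq) (diff-self-⊕ x b))) ⟩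
    toℕ (zero ⊕ b) ≡⟨ toℕ-zero⊕ b<n ⟩
    b              ∎
    where open ≡-Reasoning

  neg : Fin n → Fin n
  neg p = diff p zero

  neg-involutive : ∀ p → neg (neg p) ≡ p
  neg-involutive p = sym (diff-unique (neg p) zero p (trans (⊕-comm (neg p) p) (⊕-diff p zero)))

  -- With `b` in the role of -a this is -(p + a) = -p - a. By `diff-unique` it is enough that
  -- `p ⊕ a` and `neg p ⊕ b` add up to zero.
  neg-⊕ : ∀ p a b → a + b ≡ n → neg (p ⊕ a) ≡ neg p ⊕ b
  neg-⊕ p a b a+b≡n = sym (diff-unique (p ⊕ a) zero (neg p ⊕ b) (begin
    p ⊕ a ⊕ toℕ (neg p ⊕ b)     ≡⟨ ⊕-comm (p ⊕ a) (neg p ⊕ b) ⟩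
    neg p ⊕ b ⊕ toℕ (p ⊕ a)     ≡⟨ ⊕-swap (neg p) b (toℕ (p ⊕ a)) ⟩
    neg p ⊕ toℕ (p ⊕ a) ⊕ b     ≡⟨ cong (_⊕ b) (⊕-comm (neg p) (p ⊕ a)) ⟩
    p ⊕ a ⊕ toℕ (neg p) ⊕ b     ≡⟨ cong (_⊕ b) (⊕-swap p a (toℕ (neg p))) ⟩
    p ⊕ toℕ (neg p) ⊕ a ⊕ b     ≡⟨ ⊕-undo (p ⊕ toℕ (neg p)) a b a+b≡n ⟩
    p ⊕ toℕ (neg p)             ≡⟨ ⊕-diff p zero ⟩
    zero                        ∎))
    where open ≡-Reasoning

  -- The distance from `zero` to `p` around the cycle.
  norm : Fin n → ℕ
  norm p = toℕ p ⊓ toℕ (neg p)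

  norm-neg : ∀ p → norm (neg p) ≡ norm p
  norm-neg p = trans (cong (λ q → toℕ (neg p) ⊓ toℕ q) (neg-involutive p)) (⊓-comm (toℕ (neg p)) (toℕ p))

  -- Each minimum is attained at the residue or at its negative, which leaves four cases of equal
  -- residues up to sign.
  norm-injective : ∀ p q → norm p ≡ norm q → p ≡ q ⊎ p ≡ neg q
  norm-injective p q eq with ⊓-sel (toℕ p) (toℕ (neg p)) | ⊓-sel (toℕ q) (toℕ (neg q))
  ... | inj₁ e | inj₁ e′ = inj₁ (toℕ-injective (trans (sym e) (trans eq e′)))
  ... | inj₁ e | inj₂ e′ = inj₂ (toℕ-injective (trans (sym e) (trans eq e′)))
  ... | inj₂ e | inj₁ e′ = inj₂ (trans (sym (neg-involutive p))
                                  (cong neg (toℕ-injective (trans (sym e) (trans eq e′)))))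
  ... | inj₂ e | inj₂ e′ = inj₁ (trans (sym (neg-involutive p))
                                  (trans (cong neg (toℕ-injective (trans (sym e) (trans eq e′)))) (neg-involutive q)))

  norm-zero : ∀ {p} → norm p ≡ 0 → p ≡ zero
  norm-zero {p} eq with norm-injective p zero eq
  ... | inj₁ p≡0  = p≡0
  ... | inj₂ p≡-0 = trans p≡-0 (diff-self zero)

  norm+norm≤n : ∀ p → norm p + norm p ≤ n
  norm+norm≤n p = begin
    norm p + norm p       ≤⟨ +-mono-≤ (m⊓n≤m (toℕ p) _) (m⊓n≤n (toℕ p) _) ⟩
    toℕ p + toℕ (neg p)   ≡⟨ cong (toℕ p +_) (toℕ-⊕ zero (n ∸ toℕ p)) ⟩
    -- Only an inequality: for `p` zero the remainder is 0 and not `n`.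
    toℕ p + (n ∸ toℕ p) % n ≤⟨ +-monoʳ-≤ (toℕ p) (m%n≤m (n ∸ toℕ p) n) ⟩
    toℕ p + (n ∸ toℕ p)   ≡⟨ m+[n∸m]≡n (<⇒≤ (toℕ<n p)) ⟩
    n                     ∎
    where open ≤-Reasoning

  norm≤n/2 : ∀ p → norm p ≤ ⌊ n /2⌋
  norm≤n/2 p = subst (_≤ ⌊ n /2⌋) (sym (n≡⌊n+n/2⌋ (norm p))) (⌊n/2⌋-mono (norm+norm≤n p))

  -- In the first half of the cycle i ≤ n - i, so the minimum is `i` itself. Thus each value up to
  -- ⌊n/2⌋ has a standard representative.
  norm-small : ∀ i → i ≤ ⌊ n /2⌋ → norm (zero ⊕ i) ≡ i
  norm-small zero    _ = refl
  norm-small (suc i) i<n/2 = begin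
    toℕ p ⊓ toℕ (neg p) ≡⟨ m≤n⇒m⊓n≡m (subst₂ _≤_ (sym p≡i) (sym -p≡n-i) i≤n-i) ⟩
    toℕ p               ≡⟨ p≡i ⟩
    suc i               ∎
    where
    open ≡-Reasoning
    p = zero ⊕ suc i
    i<n : suc i < n
    i<n = ≤-<-trans i<n/2 (⌊n/2⌋<n r)
    p≡i : toℕ p ≡ suc i
    p≡i = toℕ-zero⊕ i<n
    -p≡n-i : toℕ (neg p) ≡ n ∸ suc i
    -p≡n-i = trans (cong (λ t → toℕ (zero ⊕ (n ∸ t))) p≡i) (toℕ-zero⊕ (s≤s (m∸n≤m r i)))
    i≤n-i : suc i ≤ n ∸ suc i
    i≤n-i = m+n≤o⇒m≤o∸n (suc i) (≤-trans (+-mono-≤ i<n/2 (≤-trans i<n/2 (⌊n/2⌋≤⌈n/2⌉ n))) (≤-reflexive (⌊n/2⌋+⌈n/2⌉≡n n)))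

-- The cycle of length 3 + k and its distance partitions

module CycleGraph (k : ℕ) where
  open Cyclic (2 + k) public

  private
    1<n : 1 < n
    1<n = s≤s (s≤s z≤n)

  -- `2 + k` is n - 1, so the second alternative says y = x - 1.
  Neighbour : Fin n → Fin n → Set
  Neighbour x y = x ⊕ 1 ≡ y ⊎ x ⊕ (2 + k) ≡ y

  cycle : Graph
  cycle = record
    { order  = n
    ; Adj    = Neighbour
    ; adj?   = λ x y → (x ⊕ 1 ≟ y) ⊎-dec (x ⊕ (2 + k) ≟ y)
    ; sym    = λ { {x} (inj₁ refl) → inj₂ (⊕-undo x 1 (2 + k) refl)
                 ; {x} (inj₂ refl) → inj₁ (⊕-undo x (2 + k) 1 (+-comm (2 + k) 1)) }
    ; irrefl = λ { x (inj₁ eq) → 1+n≢0 (⊕-injective x 1<n (s≤s z≤n) (trans eq (sym (⊕-0 x))))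
                 ; x (inj₂ eq) → 1+n≢0 (⊕-injective x ≤-refl (s≤s z≤n) (trans eq (sym (⊕-0 x)))) }
    }

  sumOverNeighbours-cycle : ∀ x f → sumOverNeighbours cycle x f ≡ f (x ⊕ 1) + f (x ⊕ (2 + k))
  sumOverNeighbours-cycle x f = begin
    sum (λ w → 𝟙 (next w ∨ prev w) * f w)
      ≡⟨ sum-cong-≗ (λ w → trans (cong (_* f w) (𝟙-∨ (next w) (prev w) (exclusive w))) (*-distribʳ-+ (f w) (𝟙 (next w)) (𝟙 (prev w)))) ⟩
    sum (λ w → 𝟙 (next w) * f w + 𝟙 (prev w) * f w)
      ≡⟨ ∑-distrib-+ (λ w → 𝟙 (next w) * f w) (λ w → 𝟙 (prev w) * f w) ⟩
    sum (λ w → 𝟙 (next w) * f w) + sum (λ w → 𝟙 (prev w) * f w)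
      ≡⟨ cong₂ _+_ (sum-≟ (x ⊕ 1) f) (sum-≟ (x ⊕ (2 + k)) f) ⟩
    f (x ⊕ 1) + f (x ⊕ (2 + k)) ∎
    where
    open ≡-Reasoning
    next prev : Fin n → Bool
    next w = does (x ⊕ 1 ≟ w)
    prev w = does (x ⊕ (2 + k) ≟ w)
    exclusive : ∀ w → next w ∧ prev w ≡ false
    exclusive w with x ⊕ 1 ≟ w
    ... | no _     = refl
    -- x - 1 = x + 1 would force 2 + k = 1.
    ... | yes refl = dec-false (x ⊕ (2 + k) ≟ x ⊕ 1) λ eq → 1+n≢0 (suc-injective (⊕-injective x ≤-refl 1<n eq))

  cycle-regular : Regular cycle 2
  cycle-regular v = trans (degree cycle v) (sumOverNeighbours-cycle v (λ _ → 1))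

  walk-⊕ : ∀ u a → Walk cycle u (u ⊕ a) a
  walk-⊕ u zero    = subst (λ v → Walk cycle u v 0) (sym (⊕-0 u)) []
  walk-⊕ u (suc a) = subst (λ v → Walk cycle u v (suc a)) (⊕-assoc u 1 a) (inj₁ refl ∷ walk-⊕ (u ⊕ 1) a)

  cycle-connected : Connected cycle
  cycle-connected = s≤s z≤n , λ u v → toℕ (diff u v) , subst (λ w → Walk cycle u w (toℕ (diff u v))) (⊕-diff u v) (walk-⊕ u (toℕ (diff u v)))

  -- Vertices are coloured by their distance from `u`. The reflection p ↦ -p keeps colours and swaps
  -- the two neighbours, so the colours of the neighbours depend only on the colour of the vertex.
  cycle-collapse : Collapse cycle ⌊ n /2⌋
  cycle-collapse = record
    { cell        = cell
    ; cell-refl   = λ u → cong fold (diff-self u)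
    ; cell-zero   = λ {u} {v} eq → diff-zero (norm-zero (trans (sym (toℕ-fold (diff u v))) (cong toℕ eq)))
    ; cell-onto   = λ u i → u ⊕ toℕ i , trans (cong fold (diff-self-⊕ u (toℕ i))) (fold-representative i)
    -- The entry is evaluated at the representative of colour `j` around `zero`.
    ; C           = λ i j → count i (zero ⊕ toℕ j)
    ; C-collapses = λ u i y → begin
        sumOverNeighbours cycle y (λ w → 𝟙 (does (cell u w ≟ i)))
          ≡⟨ sumOverNeighbours-cycle y (λ w → 𝟙 (does (cell u w ≟ i))) ⟩
        𝟙 (does (cell u (y ⊕ 1) ≟ i)) + 𝟙 (does (cell u (y ⊕ (2 + k)) ≟ i))
          ≡⟨ cong₂ (λ p q → 𝟙 (does (fold p ≟ i)) + 𝟙 (does (fold q ≟ i))) (diff-⊕ u y 1) (diff-⊕ u y (2 + k)) ⟩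
        count i (diff u y)
          ≡⟨ count-fold i (diff u y) (zero ⊕ toℕ (cell u y)) (sym (fold-representative (cell u y))) ⟩
        count i (zero ⊕ toℕ (cell u y)) ∎
    }
    where
    open ≡-Reasoning
    fold : Fin n → Fin (suc ⌊ n /2⌋)
    fold p = fromℕ< (s≤s (norm≤n/2 p))
    toℕ-fold : ∀ p → toℕ (fold p) ≡ norm p
    toℕ-fold p = toℕ-fromℕ< (s≤s (norm≤n/2 p))
    fold-neg : ∀ p → fold (neg p) ≡ fold p
    fold-neg p = toℕ-injective (trans (toℕ-fold (neg p)) (trans (norm-neg p) (sym (toℕ-fold p))))
    fold-representative : ∀ i → fold (zero ⊕ toℕ i) ≡ i
    fold-representative i = toℕ-injective (trans (toℕ-fold (zero ⊕ toℕ i)) (norm-small (toℕ i) (toℕ≤pred[n] i)))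
    cell : Fin n → Fin n → Fin (suc ⌊ n /2⌋)
    cell u v = fold (diff u v)
    count : Fin (suc ⌊ n /2⌋) → Fin n → ℕ
    count i p = 𝟙 (does (fold (p ⊕ 1) ≟ i)) + 𝟙 (does (fold (p ⊕ (2 + k)) ≟ i))
    count-neg : ∀ i p → count i (neg p) ≡ count i p
    count-neg i p = begin
      𝟙 (does (fold (neg p ⊕ 1) ≟ i)) + 𝟙 (does (fold (neg p ⊕ (2 + k)) ≟ i))
        ≡⟨ cong₂ (λ s t → 𝟙 (does (s ≟ i)) + 𝟙 (does (t ≟ i))) (flip (2 + k) 1 (+-comm (2 + k) 1)) (flip 1 (2 + k) refl) ⟩
      𝟙 (does (fold (p ⊕ (2 + k)) ≟ i)) + 𝟙 (does (fold (p ⊕ 1) ≟ i))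
        ≡⟨ +-comm (𝟙 (does (fold (p ⊕ (2 + k)) ≟ i))) _ ⟩
      count i p ∎
      where
      flip : ∀ a b → a + b ≡ n → fold (neg p ⊕ b) ≡ fold (p ⊕ a)
      flip a b a+b≡n = trans (cong fold (sym (neg-⊕ p a b a+b≡n))) (fold-neg (p ⊕ a))
    -- Equal colours mean p = q or p = -q, and `count-neg` settles the second case.
    count-fold : ∀ i p q → fold p ≡ fold q → count i p ≡ count i q
    count-fold i p q eq with norm-injective p q (trans (sym (toℕ-fold p)) (trans (cong toℕ eq) (toℕ-fold q)))
    ... | inj₁ refl = refl
    ... | inj₂ refl = count-neg i q

-- The family of prisms

≅⇒order≡ : ∀ {Γ Δ} → Γ ≅ Δ → order Γ ≡ order Δ
≅⇒order≡ (f , _) = ↔⇒≡ f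

module Prism (q i : ℕ) where
  -- The cycle has length 5 + i. In a triangle 0 and 2 are adjacent, and in a 4-cycle they have two
  -- common neighbours.
  open CycleGraph (2 + i)
  open Cartesian cycle (complete (2 + q))

  prism : Graph
  prism = product

  prism-connected : Connected prism
  prism-connected = connected cycle-connected (complete-connected (suc q))

  prism-regular : Regular prism (3 + q)
  prism-regular = regular cycle-regular (complete-regular (suc q))

  prism-highlyRegular : HighlyRegular prism
  prism-highlyRegular = collapse⇒highlyRegular (collapse cycle-collapse (complete-collapse q))
    -- There are (⌊n/2⌋ + 1) · 2 parts, fewer than n · 2 and hence than n · (2 + q). Two successors
    -- are stripped as ⌊(5 + i)/2⌋ computes to 1 + ⌊(3 + i)/2⌋.
    (<-≤-trans (*-monoˡ-< 2 (s≤s (s≤s (⌊n/2⌋<n (2 + i))))) (*-monoʳ-≤ n (m≤m+n 2 q)))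

  private
    distinct : ∀ {a b} → a < n → b < n → a ≢ b → zero ⊕ a ≢ zero ⊕ b
    distinct a<n b<n a≢b eq = a≢b (⊕-injective zero a<n b<n eq)

  prism-¬distanceRegular : ¬ DistanceRegular prism
  prism-¬distanceRegular = ¬distanceRegular-product {zero} {zero ⊕ 1} {zero ⊕ 2} {0F} {1F}
    (inj₁ refl) (inj₁ (⊕-assoc zero 1 1)) (distinct 0<n 2<n (λ ())) ¬0∼2 unique (λ ())
    where
    0<n : 0 < n
    0<n = s≤s z≤n
    1<n : 1 < n
    1<n = s≤s (s≤s z≤n)
    2<n : 2 < n
    2<n = s≤s (s≤s (s≤s z≤n))
    3<n : 3 < n
    3<n = s≤s (s≤s (s≤s (s≤s z≤n)))
    ¬0∼2 : ¬ Neighbour zero (zero ⊕ 2)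
    ¬0∼2 (inj₁ eq) = distinct 1<n 2<n (λ ()) eq
    ¬0∼2 (inj₂ eq) = distinct ≤-refl 2<n (λ ()) eq
    -- The other neighbour of 0 is -1 = 4 + i; adjacency to 2 would make it 3 or 1.
    unique : ∀ {w} → Neighbour zero w → Neighbour (zero ⊕ 2) w → w ≡ zero ⊕ 1
    unique (inj₁ eq)   _         = sym eq
    unique (inj₂ refl) (inj₁ eq) = contradiction (trans (sym (⊕-assoc zero 2 1)) eq) (distinct 3<n ≤-refl (λ ()))
    unique (inj₂ refl) (inj₂ eq) = contradiction
      (trans (sym (⊕-undo (zero ⊕ 1) 1 (4 + i) refl)) (trans (cong (_⊕ (4 + i)) (⊕-assoc zero 1 1)) eq))
      (distinct 1<n ≤-refl (λ ()))

open Prism using (prism; prism-connected; prism-regular; prism-highlyRegular; prism-¬distanceRegular)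

-- The order (5 + i)(2 + q) is an isomorphism invariant that determines `i`.
prism-injective : ∀ q {i j} → prism q i ≅ prism q j → i ≡ j
prism-injective q {i} {j} iso = +-cancelˡ-≡ 5 i j (*-cancelʳ-≡ (5 + i) (5 + j) (2 + q) (≅⇒order≡ {prism q i} {prism q j} iso))

theoremA4 : ∀ (k : ℕ) → 3 ≤ k →
    Σ[ Γ ∈ (ℕ → Graph) ]
    (∀ i j → i ≢ j → ¬ (Γ i ≅ Γ j)) ×
    (∀ i → Connected (Γ i) × Regular (Γ i) k × HighlyRegular (Γ i) × ¬ DistanceRegular (Γ i))
theoremA4 (suc (suc (suc q))) (s≤s (s≤s (s≤s z≤n))) =
  -- With k = 3 + q the complete factor has order k - 1 = 2 + q and contributes k - 2 to the degree;
  -- the cycle contributes 2.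
  prism q ,
  (λ i j i≢j iso → i≢j (prism-injective q iso)) ,
  (λ i → prism-connected q i , prism-regular q i , prism-highlyRegular q i , prism-¬distanceRegular q i)
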